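{- Let $G$ be a finite, bipartite, connected simple graph which does not fold to an edge and which contains neither $H_1$ nor $H_2$ as a subgraph. Then $\mathrm{Hom}(G,K_3)$ is disconnected.
   Context: $K_3$ is the complete graph on 3 vertices. For graphs $G,H$, the homomorphism complex $\mathrm{Hom}(G,H)$ is the polyhedral complex whose cells are functions $\eta:V(G)\to 2^{V(H)}\setminus\{\varnothing\}$ such that whenever $\{x,y\}\in E(G)$ we have $\eta(x)\times\eta(y)\subseteq E(H)$; the cell $\eta$ is a product of simplices of dimension $\sum_v(|\eta(v)|-1)$, with face relation $\eta\subseteq\tau$ iff $\eta(v)\subseteq\tau(v)$ for all $v$. Disconnected means nonempty with more than one path component. A fold of a graph $G$ is the passage from $G$ to the induced subgraph $G\setminus\{v\}$ where $v,u$ are distinct vertices with $N(v)\subseteq N(u)$ ($N$ denoting neighborhood); $G$ folds to an edge if some sequence of folds transforms $G$ into $K_2$. $H_1$ is the 6-cycle $a_1a_2a_3a_4a_5a_6$ together with the chord $\{a_1,a_4\}$ joining two antipodal vertices (the $2\times 3$ grid graph). $H_2$ is the complete bipartite graph $K_{2,3}$. "Contains as a subgraph" means not necessarily induced.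
   Formalization: The formal theorem also assumes that G has at least one edge; this excludes only the one-vertex graph, for which the claim fails, since Hom(K_1,K_3) is a full triangle and hence connected although K_1 does not fold to an edge. -}

module Defs where

open import Level using (0ℓ)
open import Data.Bool using (Bool)
open import Data.Fin using (Fin; punchIn; #_)
open import Data.Fin.Properties using () renaming (_≟_ to _≟ᶠ_)
open import Data.Integer using (+_)
open import Data.List using (List; []; _∷_)
open import Data.List.Membership.Propositional using () renaming (_∈_ to _∈ˡ_)
import Data.List.Membership.DecPropositional as DecMembership
open import Data.Nat as ℕ using (ℕ; suc)
import Data.Nat.Properties as ℕ
open import Data.Product using (Σ; ∃₂; ∃-syntax; _×_; _,_; proj₁; proj₂)
open import Data.Product.Properties using (≡-dec)
open import Data.Rational as ℚ using (ℚ; 0ℚ; 1ℚ; ½)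
import Data.Rational.Properties as ℚ
open import Data.Rational.Solver using (module +-*-Solver)
open import Data.Sum using (_⊎_; swap)
open import Data.Vec.Functional using (foldr)
open import Function.Bundles using (_↔_; _⇔_; Inverse)
open import Function.Definitions using (Injective)
open import Relation.Binary using (Rel; Decidable; Symmetric; Irreflexive)
open import Relation.Binary.Construct.Closure.ReflexiveTransitive using (Star)
open import Relation.Binary.PropositionalEquality
open import Relation.Nullary using (¬_)
open import Relation.Nullary.Decidable using (¬?; _×-dec_; _⊎-dec_)
open import Relation.Unary using (Pred; Satisfiable; _∈_; _⊆_)

------------------------------------------------------------------------
-- Finite simple graphs

record Graph (n : ℕ) : Set₁ where
  field
    Adj        : Rel (Fin n) 0ℓ
    Adj?       : Decidable Adj
    sym-Adj    : Symmetric Adj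
    irrefl-Adj : Irreflexive _≡_ Adj

open Graph public

K : ∀ n → Graph n
K n .Adj                = _≢_
K n .Adj? x y           = ¬? (x ≟ᶠ y)
K n .sym-Adj            = ≢-sym
K n .irrefl-Adj x≡y x≢y = x≢y x≡y

-- Edges are listed in either orientation; loops in the list are ignored.
fromEdges : ∀ {n} → List (Fin n × Fin n) → Graph n
fromEdges es .Adj x y = x ≢ y × ((x , y) ∈ˡ es ⊎ (y , x) ∈ˡ es)
fromEdges es .Adj? x y =
  ¬? (x ≟ᶠ y) ×-dec ((x , y) ∈? es ⊎-dec (y , x) ∈? es)
  where open DecMembership (≡-dec _≟ᶠ_ _≟ᶠ_) using (_∈?_)
fromEdges es .sym-Adj (x≢y , e) = ≢-sym x≢y , swap e
fromEdges es .irrefl-Adj x≡y (x≢y , _) = x≢y x≡y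

-- The vertex aᵢ of the hexagon is # (i - 1).
H₁ : Graph 6
H₁ = fromEdges ( (# 0 , # 1) ∷ (# 1 , # 2) ∷ (# 2 , # 3)
               ∷ (# 3 , # 4) ∷ (# 4 , # 5) ∷ (# 5 , # 0)
               ∷ (# 0 , # 3) ∷ [])

-- K₂,₃ with parts {0, 1} and {2, 3, 4}.
H₂ : Graph 5
H₂ = fromEdges ( (# 0 , # 2) ∷ (# 0 , # 3) ∷ (# 0 , # 4)
               ∷ (# 1 , # 2) ∷ (# 1 , # 3) ∷ (# 1 , # 4) ∷ [])

Bipartite : ∀ {n} → Graph n → Set
Bipartite {n} G = Σ (Fin n → Bool) λ side → ∀ {x y} → Adj G x y → side x ≢ side y

Connected : ∀ {n} → Graph n → Set
Connected {n} G = Fin n × (∀ x y → Star (Adj G) x y)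

-- Among connected graphs this excludes just K₁, which is bipartite and does
-- not fold to K₂, although Hom(K₁,K₃) is a triangle and hence connected.
HasEdge : ∀ {n} → Graph n → Set
HasEdge G = ∃₂ λ x y → Adj G x y

-- H ⊑ G: H is a (not necessarily induced) subgraph of G, up to isomorphism.
_⊑_ : ∀ {m n} → Graph m → Graph n → Set
_⊑_ {m} {n} H G = Σ (Fin m → Fin n) λ f →
  Injective _≡_ _≡_ f × (∀ {x y} → Adj H x y → Adj G (f x) (f y))

_≅_ : ∀ {m n} → Graph m → Graph n → Set
_≅_ {m} {n} G H = Σ (Fin m ↔ Fin n) λ f →
  ∀ x y → Adj G x y ⇔ Adj H (Inverse.to f x) (Inverse.to f y)

N : ∀ {n} (G : Graph n) → Fin n → Pred (Fin n) 0ℓ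
N G = Adj G

-- Induced subgraph on the complement of v, which punchIn v enumerates.
_∖_ : ∀ {n} → Graph (suc n) → Fin (suc n) → Graph n
(G ∖ v) .Adj x y        = Adj G (punchIn v x) (punchIn v y)
(G ∖ v) .Adj? x y       = Adj? G (punchIn v x) (punchIn v y)
(G ∖ v) .sym-Adj        = sym-Adj G
(G ∖ v) .irrefl-Adj x≡y = irrefl-Adj G (cong (punchIn v) x≡y)

data _FoldsTo_ : ∀ {m n} → Graph m → Graph n → Set₁ where
  done : ∀ {m n} {G : Graph m} {H : Graph n} → G ≅ H → G FoldsTo H
  fold : ∀ {m n} {G : Graph (suc m)} {H : Graph n} (v u : Fin (suc m)) →
         v ≢ u → N G v ⊆ N G u → (G ∖ v) FoldsTo H → G FoldsTo H

FoldsToEdge : ∀ {n} → Graph n → Set₁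
FoldsToEdge G = G FoldsTo K 2

------------------------------------------------------------------------
-- Real numbers, as Cauchy sequences of rationals

record ℝ : Set where
  field
    seq    : ℕ → ℚ
    cauchy : ∀ ε → 0ℚ ℚ.< ε → ∃[ M ] ∀ m n → M ℕ.≤ m → M ℕ.≤ n →
             ℚ.∣ seq m ℚ.- seq n ∣ ℚ.< ε

open ℝ public

infixl 6 _+_
infix  4 _<_ _≤_ _≈_

fromℚ : ℚ → ℝ
fromℚ q .seq _ = q
fromℚ q .cauchy ε 0<ε = 0 , λ _ _ _ _ →
  subst (ℚ._< ε) (sym (cong ℚ.∣_∣ (ℚ.+-inverseʳ q))) 0<ε

0ℝ 1ℝ : ℝ
0ℝ = fromℚ 0ℚ
1ℝ = fromℚ 1ℚ

_+_ : ℝ → ℝ → ℝ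
(x + y) .seq n = seq x n ℚ.+ seq y n
(x + y) .cauchy ε 0<ε =
  let ε/2 = ½ ℚ.* ε
      0<ε/2 = subst (ℚ._< ε/2) (ℚ.*-zeroʳ ½) (ℚ.*-monoʳ-<-pos ½ 0<ε)
      (M₁ , h₁) = cauchy x ε/2 0<ε/2
      (M₂ , h₂) = cauchy y ε/2 0<ε/2
  in M₁ ℕ.⊔ M₂ , λ m n M≤m M≤n →
    let open ℚ.≤-Reasoning
        dx = seq x m ℚ.- seq x n
        dy = seq y m ℚ.- seq y n
    in begin-strict
      ℚ.∣ (seq x m ℚ.+ seq y m) ℚ.- (seq x n ℚ.+ seq y n) ∣
        ≡⟨ cong ℚ.∣_∣ (rearrange (seq x m) (seq y m) (seq x n) (seq y n)) ⟩
      ℚ.∣ dx ℚ.+ dy ∣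
        ≤⟨ ℚ.∣p+q∣≤∣p∣+∣q∣ dx dy ⟩
      ℚ.∣ dx ∣ ℚ.+ ℚ.∣ dy ∣
        <⟨ ℚ.+-mono-<
             (h₁ m n (ℕ.m⊔n≤o⇒m≤o M₁ M₂ M≤m) (ℕ.m⊔n≤o⇒m≤o M₁ M₂ M≤n))
             (h₂ m n (ℕ.m⊔n≤o⇒n≤o M₁ M₂ M≤m) (ℕ.m⊔n≤o⇒n≤o M₁ M₂ M≤n)) ⟩
      ε/2 ℚ.+ ε/2
        ≡⟨ halves ε ⟩
      ε ∎
  where
  open +-*-Solver
  rearrange : ∀ a b c d →
    (a ℚ.+ b) ℚ.- (c ℚ.+ d) ≡ (a ℚ.- c) ℚ.+ (b ℚ.- d)
  rearrange = solve 4 (λ a b c d →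
    (a :+ b) :- (c :+ d) := (a :- c) :+ (b :- d)) refl
  halves : ∀ e → ½ ℚ.* e ℚ.+ ½ ℚ.* e ≡ e
  halves e = trans (sym (ℚ.*-distribʳ-+ e ½ ½)) (ℚ.*-identityˡ e)

_<_ : ℝ → ℝ → Set
x < y = ∃[ ε ] 0ℚ ℚ.< ε × ∃[ M ] ∀ n → M ℕ.≤ n → seq x n ℚ.+ ε ℚ.≤ seq y n

_≤_ : ℝ → ℝ → Set
x ≤ y = ¬ (y < x)

_≈_ : ℝ → ℝ → Set
x ≈ y = x ≤ y × y ≤ x

-- ∣ x - y ∣ < ε
Within : ℝ → ℝ → ℝ → Set
Within ε x y = x < y + ε × y < x + ε

sum : ∀ {n} → (Fin n → ℝ) → ℝ
sum = foldr _+_ 0ℝ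

------------------------------------------------------------------------
-- Homomorphism complexes

-- The cells of Hom(G,H): a set of vertices of H is a predicate on V(H).
IsCell : ∀ {m n} → Graph m → Graph n → (Fin m → Pred (Fin n) 0ℓ) → Set
IsCell G H η =
  (∀ v → Satisfiable (η v)) ×
  (∀ {x y} → Adj G x y → ∀ {i j} → i ∈ η x → j ∈ η y → Adj H i j)

-- The cell η is the product over v of the simplices spanned by η(v), sitting
-- in the product over v of the simplices spanned by V(H), with barycentric
-- coordinates; faces of η are the cells contained in it.  A point is in the
-- relative interior of η exactly when η(v) is the set of i whose coordinate
-- at v is positive, so the complex, the union of all the cells, consists of
-- the points whose support is a cell.
record Hom {m n} (G : Graph m) (H : Graph n) : Set where
  field
    coord   : Fin m → Fin n → ℝ
    nonneg  : ∀ v i → 0ℝ ≤ coord v i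
    total   : ∀ v → sum (coord v) ≈ 1ℝ
    support : IsCell G H (λ v i → 0ℝ < coord v i)

open Hom public

-- The complex is finite, so its topology is that of the maximum metric.
Near : ∀ {m n} {G : Graph m} {H : Graph n} → ℝ → Hom G H → Hom G H → Set
Near ε p q = ∀ v i → Within ε (coord p v i) (coord q v i)

_≋_ : ∀ {m n} {G : Graph m} {H : Graph n} → Hom G H → Hom G H → Set
p ≋ q = ∀ v i → coord p v i ≈ coord q v i

I : Set
I = Σ ℝ λ t → 0ℝ ≤ t × t ≤ 1ℝ

-- Continuity at s includes independence of the sequence representing s.
Continuous : ∀ {m n} {G : Graph m} {H : Graph n} → (I → Hom G H) → Set
Continuous γ = ∀ s ε → 0ℝ < ε → ∃[ δ ] 0ℝ < δ ×
  (∀ t → Within δ (proj₁ s) (proj₁ t) → Near ε (γ s) (γ t))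

record Path {m n} {G : Graph m} {H : Graph n} (p q : Hom G H) : Set where
  field
    γ          : I → Hom G H
    continuous : Continuous γ
    source     : ∀ t → proj₁ t ≈ 0ℝ → γ t ≋ p
    target     : ∀ t → proj₁ t ≈ 1ℝ → γ t ≋ q

-- Two points in different path components; in particular, nonempty.
HomDisconnected : ∀ {m n} → Graph m → Graph n → Set
HomDisconnected G H = ∃₂ λ (p q : Hom G H) → ¬ Path p q

{-# OPTIONS --safe #-}

-- Give a walk in G the sum of the steps ±1 of its colours around the triangle K₃.  For closed
-- walks this winding is the same for all colourings in one cell of Hom(G,K₃), hence constant
-- along paths, and it vanishes for the colouring by the two sides of G.  So it suffices to find
-- a proper colouring and a closed walk with nonzero winding, and folds may be undone meanwhile:
-- if N(v) ⊆ N(u), a colouring of G ∖ v extends by giving v the colour of u.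
--
-- Let D be an edge in no 4-cycle, or a 4-cycle.  Without H₁ and H₂ distinct 4-cycles share no
-- edge, so the set of outside neighbours of D is independent.  Colour it 2, exchange the two
-- sides inside D and keep them elsewhere.  If D has an edge x y and a walk off D leads from a
-- neighbour of x to a neighbour of y, closing it through y x gives winding ±6.  So suppose that
-- for no such D, x, y there is such a walk.  If G does not fold, then from D, x in D and a
-- neighbour x′ of x outside D one gets the same for the edge or 4-cycle D′ containing x x′, for
-- x′ in D′ and some x″ outside D′; the component of x″ in G ∖ D′ lies strictly inside
-- the component of x′ in G ∖ D.  This cannot go on forever.

module Submission where

open import Level using (0ℓ)
open import Data.Bool using (Bool; true; false; not)
open import Data.Bool.Properties using (¬-not; not-injective) renaming (_≟_ to _≟ᵇ_)
open import Data.Empty using (⊥; ⊥-elim)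
open import Data.Fin using (Fin; zero; suc; #_; punchIn; punchOut; funToFin; finToFun)
open import Data.Fin.Properties using (any?; all?; finToFun-funToFin; injective⇒≤; punchIn-injective; punchIn-punchOut; punchInᵢ≢i) renaming (_≟_ to _≟ᶠ_)
open import Data.Integer as ℤ using (ℤ; +_; -[1+_]; 0ℤ; 1ℤ; -1ℤ)
import Data.Integer.Properties as ℤ
import Data.List.Relation.Unary.All as List
open import Data.Nat as ℕ using (ℕ; zero; suc)
import Data.Nat.Properties as ℕ
open import Data.Product using (Σ; ∃; ∃-syntax; _×_; _,_; proj₁; proj₂)
open import Data.Rational as ℚ using (ℚ; mkℚ; 0ℚ; 1ℚ; ½; toℚᵘ)
import Data.Rational.Properties as ℚ
import Data.Rational.Solver as ℚ-Solver
open import Data.Rational.Unnormalised as ℚᵘ using (mkℚᵘ)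
import Data.Rational.Unnormalised.Properties as ℚᵘ
open import Data.Sum as Sum using (_⊎_; inj₁; inj₂; reduce)
open import Data.Vec using (Vec; []; _∷_; lookup)
open import Data.Vec.Relation.Unary.All using ([]; _∷_)
open import Data.Vec.Relation.Unary.AllPairs using ([]; _∷_)
open import Data.Vec.Relation.Unary.Unique.Propositional using (Unique)
open import Data.Vec.Relation.Unary.Unique.Propositional.Properties using (lookup-injective)
open import Function using (_∘_; id; mk⇔; mk↔ₛ′)
open import Function.Definitions using (Injective)
open import Relation.Binary using (Rel; DecidableEquality)
open import Relation.Binary.Construct.Closure.ReflexiveTransitive using (Star; ε; _◅_; _◅◅_; gmap; map)
open import Relation.Binary.PropositionalEquality
open import Relation.Nullary using (¬_; Dec; yes; no; contradiction)
open import Relation.Nullary.Decidable using (¬?; _×-dec_; _⊎-dec_; _→-dec_; toWitness; decidable-stable; map′)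
open import Algebra.Properties.AbelianGroup ℤ.+-0-abelianGroup using (∙-cancelˡ; ∙-cancelʳ)
open import Defs

private variable
  m n : ℕ

-- The winding of a walk

Proper : Graph n → (Fin n → Fin 3) → Set
Proper G c = ∀ {x y} → Adj G x y → c x ≢ c y

step : Fin 3 → Fin 3 → ℤ
step zero             (suc zero)       = 1ℤ
step (suc zero)       (suc (suc zero)) = 1ℤ
step (suc (suc zero)) zero             = 1ℤ
step (suc zero)       zero             = -1ℤ
step (suc (suc zero)) (suc zero)       = -1ℤ
step zero             (suc (suc zero)) = -1ℤ
-- Only equal colours remain, which no edge of a proper colouring has.
step _                _                = 0ℤ

-- For a closed walk, three times its winding number around the triangle K₃.
winding : {R : Rel (Fin n) 0ℓ} (c : Fin n → Fin 3) → ∀ {x y} → Star R x y → ℤ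
winding c ε                   = 0ℤ
winding c (_◅_ {i} {j} _ p) = step (c i) (c j) ℤ.+ winding c p

Wound : Graph n → Set
Wound G = Σ (Fin _ → Fin 3) λ c → Proper G c × ∃[ x ] Σ (Star (Adj G) x x) λ p → winding c p ≢ 0ℤ

module _ {R : Rel (Fin n) 0ℓ} where

  winding-◅◅ : ∀ (c : Fin n → Fin 3) {x y z} (p : Star R x y) (q : Star R y z) →
               winding c (p ◅◅ q) ≡ winding c p ℤ.+ winding c q
  winding-◅◅ c ε q = sym (ℤ.+-identityˡ _)
  winding-◅◅ c (_◅_ {i} {j} _ p) q =
    trans (cong (ℤ._+_ (step (c i) (c j))) (winding-◅◅ c p q)) (sym (ℤ.+-assoc (step (c i) (c j)) _ _))

  winding-cong : {c c′ : Fin n → Fin 3} → c ≗ c′ → ∀ {x y} (p : Star R x y) →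
                 winding c p ≡ winding c′ p
  winding-cong c≗c′ ε = refl
  winding-cong c≗c′ (_◅_ {i} {j} _ p) =
    cong₂ ℤ._+_ (cong₂ step (c≗c′ i) (c≗c′ j)) (winding-cong c≗c′ p)

  winding-gmap : {S : Rel (Fin m) 0ℓ} (c : Fin m → Fin 3) (f : Fin n → Fin m)
                 (g : ∀ {x y} → R x y → S (f x) (f y)) → ∀ {x y} (p : Star R x y) →
                 winding c (gmap {U = S} f g p) ≡ winding (c ∘ f) p
  winding-gmap {S = S} c f g ε = refl
  winding-gmap {S = S} c f g (_◅_ {i} {j} _ p) = cong (ℤ._+_ (step (c (f i)) (c (f j)))) (winding-gmap {S = S} c f g p)

  -- The sum telescopes once the colours lift to integer heights. Closed walks then get 0, and a
  -- walk between vertices of equal colour but different height gets the difference.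
  winding-potential : (c : Fin n → Fin 3) (h : Fin n → ℤ) →
    (∀ {x y} → R x y → h x ℤ.+ step (c x) (c y) ≡ h y) →
    ∀ {x y} (p : Star R x y) → h x ℤ.+ winding c p ≡ h y
  winding-potential c h e ε = ℤ.+-identityʳ _
  winding-potential c h e (_◅_ {i} {j} {k} r p) = begin
    h i ℤ.+ (step (c i) (c j) ℤ.+ winding c p) ≡⟨ ℤ.+-assoc (h i) _ _ ⟨
    h i ℤ.+ step (c i) (c j) ℤ.+ winding c p   ≡⟨ cong (ℤ._+ winding c p) (e r) ⟩
    h j ℤ.+ winding c p                        ≡⟨ winding-potential c h e p ⟩
    h k                                        ∎
    where open ≡-Reasoning

-- Recolouring a vertex moves its height by an even amount, so i ↦ i ± 1 lifts to ∓ 2.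
jump : Fin 3 → Fin 3 → ℤ
jump i j = ℤ.- (step i j ℤ.+ step i j)

-- The sets {i, i′} and {j, j′} are disjoint among three colours, so one of them is a single colour,
-- with jump 0. If the other has two colours, its jump of ±2 is the difference between a step 1 and
-- a step -1.
step-jump : ∀ i j i′ j′ → i ≢ j → i ≢ j′ → i′ ≢ j → i′ ≢ j′ →
            step i j ℤ.+ jump j j′ ≡ jump i i′ ℤ.+ step i′ j′
step-jump = toWitness {a? = all? λ i → all? λ j → all? λ i′ → all? λ j′ →
  ¬? (i ≟ᶠ j) →-dec ¬? (i ≟ᶠ j′) →-dec ¬? (i′ ≟ᶠ j) →-dec ¬? (i′ ≟ᶠ j′) →-dec
  (step i j ℤ.+ jump j j′ ℤ.≟ jump i i′ ℤ.+ step i′ j′)} _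

module _ {R : Rel (Fin n) 0ℓ} {c c′ : Fin n → Fin 3}
         (cc : ∀ {x y} → R x y → c x ≢ c y) (cc′ : ∀ {x y} → R x y → c x ≢ c′ y)
         (c′c : ∀ {x y} → R x y → c′ x ≢ c y) (c′c′ : ∀ {x y} → R x y → c′ x ≢ c′ y) where

  -- When `R` is adjacency, the four hypotheses say that v ↦ {c v, c′ v} is a cell of Hom(G,K₃). By
  -- `step-jump` the jumps telescope to those at the two ends, which cancel on a closed walk.
  winding-jump : ∀ {x y} (p : Star R x y) →
    winding c p ℤ.+ jump (c y) (c′ y) ≡ jump (c x) (c′ x) ℤ.+ winding c′ p
  winding-jump {x} ε = trans (ℤ.+-identityˡ (jump (c x) (c′ x))) (sym (ℤ.+-identityʳ (jump (c x) (c′ x))))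
  winding-jump (_◅_ {i} {j} {k} r p) = begin
    step (c i) (c j) ℤ.+ winding c p ℤ.+ jump (c k) (c′ k)
      ≡⟨ ℤ.+-assoc (step (c i) (c j)) _ _ ⟩
    step (c i) (c j) ℤ.+ (winding c p ℤ.+ jump (c k) (c′ k))
      ≡⟨ cong (ℤ._+_ (step (c i) (c j))) (winding-jump p) ⟩
    step (c i) (c j) ℤ.+ (jump (c j) (c′ j) ℤ.+ winding c′ p)
      ≡⟨ ℤ.+-assoc (step (c i) (c j)) _ _ ⟨
    step (c i) (c j) ℤ.+ jump (c j) (c′ j) ℤ.+ winding c′ p
      ≡⟨ cong (ℤ._+ winding c′ p)
           (step-jump (c i) (c j) (c′ i) (c′ j) (cc r) (cc′ r) (c′c r) (c′c′ r)) ⟩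
    jump (c i) (c′ i) ℤ.+ step (c′ i) (c′ j) ℤ.+ winding c′ p
      ≡⟨ ℤ.+-assoc (jump (c i) (c′ i)) _ _ ⟩
    jump (c i) (c′ i) ℤ.+ (step (c′ i) (c′ j) ℤ.+ winding c′ p) ∎
    where open ≡-Reasoning

  winding-invariant : ∀ {x} (p : Star R x x) → winding c p ≡ winding c′ p
  winding-invariant {x} p = ∙-cancelˡ (jump (c x) (c′ x)) _ _
    (trans (ℤ.+-comm (jump (c x) (c′ x)) _) (winding-jump p))

-- Colourings are enumerated by the numbers below m ^ n. Decoding returns a colouring only up to
-- pointwise equality, which `P` must therefore respect.
any-colouring? : {P : (Fin n → Fin m) → Set} → (∀ c → Dec (P c)) →
                 (∀ {c c′} → c ≗ c′ → P c → P c′) → Dec (∃ P)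
any-colouring? {n} {m} {P} P? transport =
  map′ (λ (k , Pk) → finToFun k , Pk)
       (λ (c , Pc) → funToFin c , transport (sym ∘ finToFun-funToFin c) Pc)
       (any? λ k → P? (finToFun k))

-- With a closed walk r → x → y → r for every edge x y and one r → y → r for every vertex,
-- all closed walks have winding zero as soon as these finitely many do.
wound? : (G : Graph n) → Connected G → Dec (Wound G)
wound? {n} G (r , walk) = map′ to from
  (any-colouring? (λ c → proper? c ×-dec bad? c) transport)
  where
  Proper′ : (Fin n → Fin 3) → Set
  Proper′ c = ∀ x y → Adj G x y → c x ≢ c y
  proper? : ∀ c → Dec (Proper′ c)
  proper? c = all? λ x → all? λ y → Adj? G x y →-dec ¬? (c x ≟ᶠ c y)
  spoke : ∀ y → Star (Adj G) r r
  spoke y = walk r y ◅◅ walk y r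
  rim : ∀ {x y} → Adj G x y → Star (Adj G) r r
  rim {x} {y} e = walk r x ◅◅ e ◅ walk y r
  Bad : (Fin n → Fin 3) → Set
  Bad c = ∃[ x ] ∃[ y ] Σ (Adj G x y) λ e → winding c (spoke y) ≢ 0ℤ ⊎ winding c (rim e) ≢ 0ℤ
  bad? : ∀ c → Dec (Bad c)
  bad? c = any? λ x → any? λ y → bad-edge? x y
    where
    -- The winding of `rim e` written without `e`, so that one verdict covers every proof of
    -- adjacency.
    rimℤ : ∀ x y → ℤ
    rimℤ x y = winding c (walk r x) ℤ.+ (step (c x) (c y) ℤ.+ winding c (walk y r))
    bad-edge? : ∀ x y → Dec (Σ (Adj G x y) λ e → winding c (spoke y) ≢ 0ℤ ⊎ winding c (rim e) ≢ 0ℤ)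
    bad-edge? x y with Adj? G x y
    ... | no ¬e = no (¬e ∘ proj₁)
    ... | yes e with ¬? (winding c (spoke y) ℤ.≟ 0ℤ) ⊎-dec ¬? (rimℤ x y ℤ.≟ 0ℤ)
    ...   | yes (inj₁ b) = yes (e , inj₁ b)
    ...   | yes (inj₂ b) = yes (e , inj₂ (b ∘ trans (sym (winding-◅◅ c (walk r x) (e ◅ walk y r)))))
    ...   | no ¬b = no λ where
      (_ , inj₁ b) → ¬b (inj₁ b)
      (e′ , inj₂ b) → ¬b (inj₂ (b ∘ trans (winding-◅◅ c (walk r x) (e′ ◅ walk y r))))
  transport : ∀ {c c′} → c ≗ c′ → Proper′ c × Bad c → Proper′ c′ × Bad c′
  transport eq (prop , x , y , e , bad) =
    (λ x y e c′≡ → prop x y e (trans (eq x) (trans c′≡ (sym (eq y))))) , x , y , e , bad′ bad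
    where
    bad′ : _ ⊎ _ → _ ⊎ _
    bad′ (inj₁ b) = inj₁ (b ∘ trans (winding-cong eq (spoke y)))
    bad′ (inj₂ b) = inj₂ (b ∘ trans (winding-cong eq (rim e)))
  to : ∃ (λ c → Proper′ c × Bad c) → Wound G
  to (c , prop , x , y , e , inj₁ b) = c , prop _ _ , r , spoke y , b
  to (c , prop , x , y , e , inj₂ b) = c , prop _ _ , r , rim e , b
  from : Wound G → ∃ (λ c → Proper′ c × Bad c)
  from (c , prop , x , p , p≢0) = c , (λ _ _ → prop) , decidable-stable (bad? c) λ ¬bad →
    -- `rim e` and `spoke y` share the way back from y. Cancelling it makes the winding of
    -- `walk r y` a height function for `c`.
    let good : ∀ {x y} → Adj G x y → winding c (walk r x) ℤ.+ step (c x) (c y) ≡ winding c (walk r y)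
        good {x} {y} e = ∙-cancelʳ (winding c (walk y r)) _ _ (trans (ℤ.+-assoc (winding c (walk r x)) _ _)
          (trans (sym (winding-◅◅ c (walk r x) (e ◅ walk y r)))
          (trans (decidable-stable (_ ℤ.≟ 0ℤ) λ b → ¬bad (x , y , e , inj₂ b))
          (trans (sym (decidable-stable (_ ℤ.≟ 0ℤ) λ b → ¬bad (x , y , e , inj₁ b)))
            (winding-◅◅ c (walk r y) (walk y r))))))
    in p≢0 (∙-cancelˡ (winding c (walk r x)) _ _ (trans
         (winding-potential c (λ y → winding c (walk r y)) good p) (sym (ℤ.+-identityʳ _))))

-- Colourings of bipartite graphs with a flipped block

fromEdges-⊑ : ∀ {es} (G : Graph n) (vs : Vec (Fin n) m) → Unique vs →
  List.All (λ (i , j) → Adj G (lookup vs i) (lookup vs j)) es → fromEdges es ⊑ G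
fromEdges-⊑ G vs vs! adj =
  lookup vs , (λ {i} {j} → lookup-injective vs! i j) , λ where
    (_ , inj₁ ij∈es) → List.lookup adj ij∈es
    (_ , inj₂ ji∈es) → sym-Adj G (List.lookup adj ji∈es)

paint : Bool → Fin 3
paint false = # 0
paint true  = # 1

-- `A` stands for lying in the flipped set and `B` for having a neighbour there. Taking the
-- decisions as arguments turns the checks below into case analyses free of graphs.
shade : {A B : Set} → Dec A → Dec B → Bool → Fin 3
shade (yes _) _       s = paint (not s)
shade (no _)  (yes _) s = # 2
shade (no _)  (no _)  s = paint s

paint-injective : ∀ {a b} → paint a ≡ paint b → a ≡ b
paint-injective {false} {false} _ = refl
paint-injective {true}  {true}  _ = refl

paint≢2 : ∀ a → paint a ≢ # 2
paint≢2 false ()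
paint≢2 true  ()

shade-proper : {A B A′ B′ : Set} (a? : Dec A) (b? : Dec B) (a′? : Dec A′) (b′? : Dec B′) →
  (A → ¬ A′ → B′) → (A′ → ¬ A → B) → (¬ A → ¬ A′ → B → ¬ B′) →
  ∀ s s′ → s ≢ s′ → shade a? b? s ≢ shade a′? b′? s′
shade-proper (yes _)  _        (yes _)  _         _  _  _   s s′ s≢ = s≢ ∘ not-injective ∘ paint-injective {not s}
shade-proper (yes _)  _        (no _)   (yes _)   _  _  _   s s′ _  = paint≢2 (not s)
shade-proper (yes a)  _        (no ¬a′) (no ¬b′)  ab _  _   s s′ _  = contradiction (ab a ¬a′) ¬b′
shade-proper (no _)   (yes _)  (yes _)  _         _  _  _   s s′ _  = ≢-sym (paint≢2 (not s′))
shade-proper (no ¬a)  (no ¬b)  (yes a′) _         _  ba _   s s′ _  = contradiction (ba a′ ¬a) ¬b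
shade-proper (no ¬a)  (yes b)  (no ¬a′) (yes b′)  _  _  ind s s′ _  = contradiction b′ (ind ¬a ¬a′ b)
shade-proper (no _)   (yes _)  (no _)   (no _)    _  _  _   s s′ _  = ≢-sym (paint≢2 s′)
shade-proper (no _)   (no _)   (no _)   (yes _)   _  _  _   s s′ _  = paint≢2 s
shade-proper (no _)   (no _)   (no _)   (no _)    _  _  _   s s′ s≢ = s≢ ∘ paint-injective {s}

shade-yes : {A B : Set} (a? : Dec A) (b? : Dec B) {s : Bool} → A → shade a? b? s ≡ paint (not s)
shade-yes (yes _) _ _ = refl
shade-yes (no ¬a) _ a = contradiction a ¬a

shade-no-yes : {A B : Set} (a? : Dec A) (b? : Dec B) {s : Bool} → ¬ A → B → shade a? b? s ≡ # 2
shade-no-yes (yes a) _       ¬a _ = contradiction a ¬a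
shade-no-yes (no _)  (yes _) _  _ = refl
shade-no-yes (no _)  (no ¬b) _  b = contradiction b ¬b

-- An integer lift, of parity given by s, of the colour mod 3 of a vertex outside the flipped set.
level : {B : Set} → Dec B → Bool → ℤ
level (yes _) false = + 2
level (yes _) true  = -1ℤ
level (no _)  false = 0ℤ
level (no _)  true  = 1ℤ

-- Levels of opposite parity differ by ±1, matching the step of the colours, except for 2 and -1.
-- That pair would need both vertices next to the flipped set, which `B → ¬ B′` excludes.
step-level : {A B A′ B′ : Set} (a? : Dec A) (b? : Dec B) (a′? : Dec A′) (b′? : Dec B′) →
  ¬ A → ¬ A′ → (B → ¬ B′) → ∀ s s′ → s ≢ s′ →
  level b? s ℤ.+ step (shade a? b? s) (shade a′? b′? s′) ≡ level b′? s′
step-level (yes a) _       _        _        ¬a _   _   _     _     _  = contradiction a ¬a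
step-level (no _)  _       (yes a′) _        _  ¬a′ _   _     _     _  = contradiction a′ ¬a′
step-level (no _)  (yes b) (no _)   (yes b′) _  _   ind _     _     _  = contradiction b′ (ind b)
step-level (no _)  _       (no _)   _        _  _   _   false false s≢ = contradiction refl s≢
step-level (no _)  _       (no _)   _        _  _   _   true  true  s≢ = contradiction refl s≢
step-level (no _)  (yes _) (no _)   (no _)   _  _   _   false true  _  = refl
step-level (no _)  (yes _) (no _)   (no _)   _  _   _   true  false _  = refl
step-level (no _)  (no _)  (no _)   (yes _)  _  _   _   false true  _  = refl
step-level (no _)  (no _)  (no _)   (yes _)  _  _   _   true  false _  = refl
step-level (no _)  (no _)  (no _)   (no _)   _  _   _   false true  _  = refl
step-level (no _)  (no _)  (no _)   (no _)   _  _   _   true  false _  = refl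

-- 2 is adjacent to both sides of the flipped set; a detour adds 3 or -3, and the way back as much.
level-detour : {B B′ : Set} (b? : Dec B) (b′? : Dec B′) → B → B′ → ∀ s w →
  level b? (not s) ℤ.+ w ≡ level b′? s →
  step (paint (not s)) (# 2) ℤ.+ (w ℤ.+ (step (# 2) (paint s) ℤ.+ (step (paint s) (paint (not s)) ℤ.+ 0ℤ))) ≢ 0ℤ
level-detour (no ¬b) _        b _  _     _ _  = contradiction b ¬b
level-detour (yes _) (no ¬b′) _ b′ _     _ _  = contradiction b′ ¬b′
level-detour (yes _) (yes _)  _ _  false w eq with ∙-cancelˡ -1ℤ w (+ 3) eq
... | refl = λ ()
level-detour (yes _) (yes _)  _ _  true  w eq with ∙-cancelˡ (+ 2) w -[1+ 2 ] eq
... | refl = λ ()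

module Bipartition (G : Graph n) (side : Fin n → Bool)
                   (bip : ∀ {x y} → Adj G x y → side x ≢ side y) where

  private
    infix 4 _~_
    _~_ : Rel (Fin n) 0ℓ
    _~_ = Adj G

    ~-sym : ∀ {x y} → x ~ y → y ~ x
    ~-sym = sym-Adj G

    ~⇒≢ : ∀ {x y} → x ~ y → x ≢ y
    ~⇒≢ x~y x≡y = irrefl-Adj G x≡y x~y

  flip : ∀ {x y} → x ~ y → side x ≡ not (side y)
  flip = ¬-not ∘ bip

  even : ∀ {x y z} → x ~ y → y ~ z → side x ≡ side z
  even x~y y~z = not-injective (trans (sym (flip (~-sym x~y))) (flip y~z))

  odd : ∀ {w x y z} → w ~ x → x ~ y → y ~ z → side w ≢ side z
  odd w~x x~y y~z = subst (λ s → s ≢ side _) (sym (even w~x x~y)) (bip y~z)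

  even≁ : ∀ {x y} → side x ≡ side y → ¬ x ~ y
  even≁ eq x~y = bip x~y eq

  proper₂ : Proper G (paint ∘ side)
  proper₂ xy = bip xy ∘ paint-injective

  winding₂ : ∀ {x} (p : Star _~_ x x) → winding (paint ∘ side) p ≡ 0ℤ
  winding₂ {x} p = ∙-cancelˡ (h x) _ _ (trans
    (winding-potential (paint ∘ side) h
      (λ {u} {v} u~v → step-level {B = ⊥} {B′ = ⊥} (no id) (no id) (no id) (no id) id id (λ ())
        (side u) (side v) (bip u~v))
      p)
    (sym (ℤ.+-identityʳ (h x))))
    where
    h : Fin _ → ℤ
    h = level {⊥} (no id) ∘ side

  -- What an edge in no 4-cycle and a 4-cycle have in common. `closed` says that a 4-cycle through
  -- an edge of `D` stays in `D`; it is stated for the corner `s`, and exchanging `u` with `v` gives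
  -- `t`.
  record Block : Set₁ where
    field
      D        : Fin n → Set
      D?       : ∀ v → Dec (D v)
      biclique : ∀ {u v} → D u → D v → side u ≢ side v → u ~ v
      closed   : ∀ {u v s t} → D u → D v → u ~ v → u ~ s → s ~ t → t ~ v → s ≢ v → t ≢ u → D s

    Off : Rel (Fin n) 0ℓ
    Off u v = ¬ D u × ¬ D v × u ~ v

    Off-end : ∀ {u v} → ¬ D u → Star Off u v → ¬ D v
    Off-end ¬Du ε                  = ¬Du
    Off-end _   ((_ , ¬Dv , _) ◅ p) = Off-end ¬Dv p

    Next : Fin n → Set
    Next v = ∃[ d ] D d × v ~ d

    Next? : ∀ v → Dec (Next v)
    Next? v = any? λ d → D? d ×-dec Adj? G v d

    -- The neighbours d and d′ in `D` are on opposite sides, hence adjacent, so d s t d′ is a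
    -- 4-cycle through an edge of `D` and `closed` pulls s into `D`.
    independent : ∀ {s t} → s ~ t → ¬ D s → ¬ D t → Next s → ¬ Next t
    independent {s} {t} s~t ¬Ds ¬Dt (d , Dd , s~d) (d′ , Dd′ , t~d′) =
      ¬Ds (closed Dd Dd′ (biclique Dd Dd′ (odd (~-sym s~d) s~t t~d′)) (~-sym s~d) s~t t~d′
        (λ { refl → ¬Ds Dd′ }) (λ { refl → ¬Dt Dd }))

    colour : Fin n → Fin 3
    colour v = shade (D? v) (Next? v) (side v)

    colour-proper : Proper G colour
    colour-proper {x} {y} x~y = shade-proper (D? x) (Next? x) (D? y) (Next? y)
      (λ Dx _ → x , Dx , ~-sym x~y) (λ Dy _ → y , Dy , x~y) (independent x~y) (side x) (side y) (bip x~y)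

    -- Both x′ and y′ have colour 2 but they lie on opposite sides, so their levels are 2 and -1 and
    -- the walk between them winds by ±3. The three edges through y and x add ±3 in the same
    -- direction.
    detour-wound : ∀ {x y x′ y′} → D x → D y → x ~ y → x ~ x′ → y ~ y′ → ¬ D x′ → ¬ D y′ →
                   Star Off x′ y′ → Wound G
    detour-wound {x} {y} {x′} {y′} Dx Dy x~y x~x′ y~y′ ¬Dx′ ¬Dy′ p =
      colour , colour-proper , x , x~x′ ◅ (p′ ◅◅ ~-sym y~y′ ◅ ~-sym x~y ◅ ε) , λ w≡0 →
        level-detour (Next? x′) (Next? y′) Nx′ Ny′ (side x) (winding colour p) levels (trans (sym total-winding) w≡0)
      where
      p′ : Star _~_ x′ y′
      p′ = map (proj₂ ∘ proj₂) p
      Nx′ : Next x′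
      Nx′ = x , Dx , ~-sym x~x′
      Ny′ : Next y′
      Ny′ = y , Dy , ~-sym y~y′
      cx : colour x ≡ paint (not (side x))
      cx = shade-yes (D? x) (Next? x) Dx
      cy : colour y ≡ paint (side x)
      cy = trans (shade-yes (D? y) (Next? y) Dy) (cong paint (sym (flip x~y)))
      cx′ : colour x′ ≡ # 2
      cx′ = shade-no-yes (D? x′) (Next? x′) ¬Dx′ Nx′
      cy′ : colour y′ ≡ # 2
      cy′ = shade-no-yes (D? y′) (Next? y′) ¬Dy′ Ny′
      levels : level (Next? x′) (not (side x)) ℤ.+ winding colour p ≡ level (Next? y′) (side x)
      levels = subst₂ (λ s s′ → level (Next? x′) s ℤ.+ winding colour p ≡ level (Next? y′) s′)
        (flip (~-sym x~x′)) (sym (even x~y y~y′))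
        (winding-potential colour (λ v → level (Next? v) (side v))
          (λ {u} {v} (¬Du , ¬Dv , u~v) → step-level (D? u) (Next? u) (D? v) (Next? v)
            ¬Du ¬Dv (independent u~v ¬Du ¬Dv) (side u) (side v) (bip u~v))
          p)
      total-winding : winding colour (x~x′ ◅ (p′ ◅◅ ~-sym y~y′ ◅ ~-sym x~y ◅ ε)) ≡ _
      total-winding = cong₂ ℤ._+_ (cong₂ step cx cx′) (trans
        (winding-◅◅ colour p′ (~-sym y~y′ ◅ ~-sym x~y ◅ ε))
        (cong₂ ℤ._+_ (winding-gmap colour (λ v → v) (proj₂ ∘ proj₂) p)
          (cong₂ ℤ._+_ (cong₂ step cy′ cy) (cong (ℤ._+ 0ℤ) (cong₂ step cy cx)))))

  -- 4-cycles, and the copies of H₂ and H₁ that two of them form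

  record Square (a b c d : Fin n) : Set where
    constructor square
    field
      ab  : a ~ b
      bc  : b ~ c
      cd  : c ~ d
      da  : d ~ a
      a≢c : a ≢ c
      b≢d : b ≢ d

  rotate : ∀ {a b c d} → Square a b c d → Square b c d a
  rotate (square ab bc cd da a≢c b≢d) = square bc cd da ab b≢d (≢-sym a≢c)

  reflect : ∀ {a b c d} → Square a b c d → Square a d c b
  reflect (square ab bc cd da a≢c b≢d) =
    square (~-sym da) (~-sym cd) (~-sym bc) (~-sym ab) a≢c (≢-sym b≢d)

  -- {a, b, c, d} when a b c d is a square, and the edge {a, b} when c = a and d = b.
  Corner : (a b c d : Fin n) → Fin n → Set
  Corner a b c d v = (v ≡ a ⊎ v ≡ c) ⊎ (v ≡ b ⊎ v ≡ d)

  Corner? : ∀ a b c d v → Dec (Corner a b c d v)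
  Corner? a b c d v = (v ≟ᶠ a ⊎-dec v ≟ᶠ c) ⊎-dec (v ≟ᶠ b ⊎-dec v ≟ᶠ d)

  -- Stated for closed walks a b c d a, which covers 4-cycles and also a single edge as the walk a b
  -- a b.
  corner-biclique : ∀ {a b c d} → a ~ b → b ~ c → c ~ d → d ~ a → ∀ {u v} →
    Corner a b c d u → Corner a b c d v → side u ≢ side v → u ~ v
  corner-biclique {a} {b} {c} {d} ab bc cd da = go
    where
    go : ∀ {u v} → Corner a b c d u → Corner a b c d v → side u ≢ side v → u ~ v
    go (inj₁ (inj₁ refl)) (inj₁ (inj₁ refl)) odd = contradiction refl odd
    go (inj₁ (inj₁ refl)) (inj₁ (inj₂ refl)) odd = contradiction (even ab bc) odd
    go (inj₁ (inj₂ refl)) (inj₁ (inj₁ refl)) odd = contradiction (even cd da) odd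
    go (inj₁ (inj₂ refl)) (inj₁ (inj₂ refl)) odd = contradiction refl odd
    go (inj₂ (inj₁ refl)) (inj₂ (inj₁ refl)) odd = contradiction refl odd
    go (inj₂ (inj₁ refl)) (inj₂ (inj₂ refl)) odd = contradiction (even bc cd) odd
    go (inj₂ (inj₂ refl)) (inj₂ (inj₁ refl)) odd = contradiction (even da ab) odd
    go (inj₂ (inj₂ refl)) (inj₂ (inj₂ refl)) odd = contradiction refl odd
    go (inj₁ (inj₁ refl)) (inj₂ (inj₁ refl)) _   = ab
    go (inj₁ (inj₁ refl)) (inj₂ (inj₂ refl)) _   = ~-sym da
    go (inj₁ (inj₂ refl)) (inj₂ (inj₁ refl)) _   = ~-sym bc
    go (inj₁ (inj₂ refl)) (inj₂ (inj₂ refl)) _   = cd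
    go (inj₂ (inj₁ refl)) (inj₁ (inj₁ refl)) _   = ~-sym ab
    go (inj₂ (inj₁ refl)) (inj₁ (inj₂ refl)) _   = bc
    go (inj₂ (inj₂ refl)) (inj₁ (inj₁ refl)) _   = da
    go (inj₂ (inj₂ refl)) (inj₁ (inj₂ refl)) _   = ~-sym cd

  K₂,₃-⊑ : ∀ {a c b d s} → a ~ b → a ~ d → a ~ s → c ~ b → c ~ d → c ~ s →
           a ≢ c → b ≢ d → b ≢ s → d ≢ s → H₂ ⊑ G
  K₂,₃-⊑ {a} {c} {b} {d} {s} ab ad as cb cd cs a≢c b≢d b≢s d≢s =
    fromEdges-⊑ G (a ∷ c ∷ b ∷ d ∷ s ∷ [])
      ( (a≢c ∷ ~⇒≢ ab ∷ ~⇒≢ ad ∷ ~⇒≢ as ∷ [])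
      ∷ (~⇒≢ cb ∷ ~⇒≢ cd ∷ ~⇒≢ cs ∷ [])
      ∷ (b≢d ∷ b≢s ∷ [])
      ∷ (d≢s ∷ [])
      ∷ [] ∷ [])
      (ab List.∷ ad List.∷ as List.∷ cb List.∷ cd List.∷ cs List.∷ List.[])

  -- The hexagon is a d c b t s and its chord is a b. The inequalities d ≢ t and c ≢ s hold by
  -- parity.
  domino-⊑ : ∀ {a b c d s t} → Square a b c d → a ~ s → s ~ t → t ~ b →
             s ≢ b → t ≢ a → s ≢ d → t ≢ c → H₁ ⊑ G
  domino-⊑ {a} {b} {c} {d} {s} {t} (square ab bc cd da a≢c b≢d) as st tb s≢b t≢a s≢d t≢c =
    fromEdges-⊑ G (a ∷ d ∷ c ∷ b ∷ t ∷ s ∷ [])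
      ( (≢-sym (~⇒≢ da) ∷ a≢c ∷ ~⇒≢ ab ∷ ≢-sym t≢a ∷ ~⇒≢ as ∷ [])
      ∷ (≢-sym (~⇒≢ cd) ∷ ≢-sym b≢d ∷ odd⇒≢ da as st ∷ ≢-sym s≢d ∷ [])
      ∷ (≢-sym (~⇒≢ bc) ∷ ≢-sym t≢c ∷ odd⇒≢ (~-sym bc) (~-sym tb) (~-sym st) ∷ [])
      ∷ (≢-sym (~⇒≢ tb) ∷ ≢-sym s≢b ∷ [])
      ∷ (≢-sym (~⇒≢ st) ∷ [])
      ∷ [] ∷ [])
      (~-sym da List.∷ ~-sym cd List.∷ ~-sym bc List.∷ ~-sym tb List.∷ ~-sym st List.∷ ~-sym as
        List.∷ ab List.∷ List.[])
    where
    odd⇒≢ : ∀ {w x y z} → w ~ x → x ~ y → y ~ z → w ≢ z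
    odd⇒≢ wx xy yz w≡z = odd wx xy yz (cong side w≡z)

  -- The descent in a graph without folds and without winding

  module Descent (¬H₁ : ¬ (H₁ ⊑ G)) (¬H₂ : ¬ (H₂ ⊑ G)) (¬wound : ¬ Wound G)
                 (stiff : ∀ {v u} → v ≢ u → ∃[ z ] v ~ z × ¬ u ~ z)
                 (¬leaf : ∀ {x y} → x ~ y → ∃[ z ] y ~ z × z ≢ x) where

    -- Otherwise the 4-cycles a b c d and a b t s make a K₂,₃ with parts {a, c} and {b, d, s} if t =
    -- c, and a hexagon with chord a b if not.
    square-unique : ∀ {a b c d s t} → Square a b c d → a ~ s → s ~ t → t ~ b → s ≢ b → t ≢ a → s ≡ d
    square-unique {c = c} {d} {s} {t} sq@(square ab bc cd da a≢c b≢d) as st tb s≢b t≢a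
      with s ≟ᶠ d | t ≟ᶠ c
    ... | yes s≡d | _        = s≡d
    ... | no  s≢d | yes refl = contradiction
      (K₂,₃-⊑ ab (~-sym da) as (~-sym bc) cd (~-sym st) a≢c b≢d (≢-sym s≢b) (≢-sym s≢d)) ¬H₂
    ... | no  s≢d | no  t≢c  = contradiction (domino-⊑ sq as st tb s≢b t≢a s≢d t≢c) ¬H₁

    -- `twin` supplies the fourth corner of the 4-cycle on v, x, y, and is vacuous for an edge.
    -- `escape` supplies the way out to the next stage.
    record BlockAt (x y : Fin n) : Set₁ where
      field
        block : Block
      open Block block public
      field
        Dx     : D x
        Dy     : D y
        twin   : ∀ {v} → D v → x ~ v → v ≢ y → ∃[ p ] p ≢ x × y ~ p × p ~ v
        escape : ∃[ z ] y ~ z × ¬ D z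

    squareBlock : ∀ {a b c d} → Square a b c d → BlockAt a b
    squareBlock {a} {b} {c} {d} sq@(square ab bc cd da a≢c b≢d) = record
      { block  = record
        { D = Corner a b c d ; D? = Corner? a b c d
        ; biclique = corner-biclique ab bc cd da ; closed = closed }
      ; Dx     = inj₁ (inj₁ refl)
      ; Dy     = inj₂ (inj₁ refl)
      ; twin   = λ where
          (inj₁ (inj₁ refl)) av _   → contradiction av (even≁ refl)
          (inj₁ (inj₂ refl)) av _   → contradiction av (even≁ (even ab bc))
          (inj₂ (inj₁ refl)) _  v≢b → contradiction refl v≢b
          (inj₂ (inj₂ refl)) _  _   → c , ≢-sym a≢c , bc , cd
      -- A neighbour of b but not of d is neither a nor c, and parity rules out b and d.
      ; escape = let (z , b~z , ¬d~z) = stiff b≢d in z , b~z , outside b~z ¬d~z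
      }
      where
      outside : ∀ {z} → b ~ z → ¬ d ~ z → ¬ Corner a b c d z
      outside _   ¬d~z (inj₁ (inj₁ refl)) = ¬d~z da
      outside _   ¬d~z (inj₁ (inj₂ refl)) = ¬d~z (~-sym cd)
      outside b~z _    (inj₂ (inj₁ refl)) = even≁ refl b~z
      outside b~z _    (inj₂ (inj₂ refl)) = even≁ (even bc cd) b~z
      closed : ∀ {u v s t} → Corner a b c d u → Corner a b c d v → u ~ v →
               u ~ s → s ~ t → t ~ v → s ≢ v → t ≢ u → Corner a b c d s
      closed (inj₁ (inj₁ refl)) (inj₁ (inj₁ refl)) uv = contradiction uv (even≁ refl)
      closed (inj₁ (inj₁ refl)) (inj₁ (inj₂ refl)) uv = contradiction uv (even≁ (even ab bc))
      closed (inj₁ (inj₂ refl)) (inj₁ (inj₁ refl)) uv = contradiction uv (even≁ (even cd da))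
      closed (inj₁ (inj₂ refl)) (inj₁ (inj₂ refl)) uv = contradiction uv (even≁ refl)
      closed (inj₂ (inj₁ refl)) (inj₂ (inj₁ refl)) uv = contradiction uv (even≁ refl)
      closed (inj₂ (inj₁ refl)) (inj₂ (inj₂ refl)) uv = contradiction uv (even≁ (even bc cd))
      closed (inj₂ (inj₂ refl)) (inj₂ (inj₁ refl)) uv = contradiction uv (even≁ (even da ab))
      closed (inj₂ (inj₂ refl)) (inj₂ (inj₂ refl)) uv = contradiction uv (even≁ refl)
      closed (inj₁ (inj₁ refl)) (inj₂ (inj₁ refl)) _ us st tv s≢v t≢u =
        inj₂ (inj₂ (square-unique sq us st tv s≢v t≢u))
      closed (inj₁ (inj₁ refl)) (inj₂ (inj₂ refl)) _ us st tv s≢v t≢u =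
        inj₂ (inj₁ (square-unique (reflect sq) us st tv s≢v t≢u))
      closed (inj₁ (inj₂ refl)) (inj₂ (inj₁ refl)) _ us st tv s≢v t≢u =
        inj₂ (inj₂ (square-unique (reflect (rotate (rotate sq))) us st tv s≢v t≢u))
      closed (inj₁ (inj₂ refl)) (inj₂ (inj₂ refl)) _ us st tv s≢v t≢u =
        inj₂ (inj₁ (square-unique (rotate (rotate sq)) us st tv s≢v t≢u))
      closed (inj₂ (inj₁ refl)) (inj₁ (inj₁ refl)) _ us st tv s≢v t≢u =
        inj₁ (inj₂ (square-unique (reflect (rotate sq)) us st tv s≢v t≢u))
      closed (inj₂ (inj₁ refl)) (inj₁ (inj₂ refl)) _ us st tv s≢v t≢u =
        inj₁ (inj₁ (square-unique (rotate sq) us st tv s≢v t≢u))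
      closed (inj₂ (inj₂ refl)) (inj₁ (inj₁ refl)) _ us st tv s≢v t≢u =
        inj₁ (inj₂ (square-unique (rotate (rotate (rotate sq))) us st tv s≢v t≢u))
      closed (inj₂ (inj₂ refl)) (inj₁ (inj₂ refl)) _ us st tv s≢v t≢u =
        inj₁ (inj₁ (square-unique (reflect (rotate (rotate (rotate sq)))) us st tv s≢v t≢u))

    edgeBlock : ∀ {a b} → a ~ b → (∀ {c d} → ¬ Square a b c d) → BlockAt a b
    edgeBlock {a} {b} ab ¬square = record
      { block  = record
        { D = Corner a b a b ; D? = Corner? a b a b
        ; biclique = corner-biclique ab (~-sym ab) ab (~-sym ab)
        ; closed = λ Du Dv uv us st tv s≢v t≢u →
            ⊥-elim (¬closed (Sum.map reduce reduce Du) (Sum.map reduce reduce Dv) uv us st tv s≢v t≢u) }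
      ; Dx     = inj₁ (inj₁ refl)
      ; Dy     = inj₂ (inj₁ refl)
      ; twin   = λ where
          (inj₁ (inj₁ refl)) av _   → contradiction av (even≁ refl)
          (inj₁ (inj₂ refl)) av _   → contradiction av (even≁ refl)
          (inj₂ (inj₁ refl)) _  v≢b → contradiction refl v≢b
          (inj₂ (inj₂ refl)) _  v≢b → contradiction refl v≢b
      ; escape = let (z , b~z , z≢a) = ¬leaf ab in z , b~z , outside b~z z≢a
      }
      where
      outside : ∀ {z} → b ~ z → z ≢ a → ¬ Corner a b a b z
      outside _   z≢a (inj₁ z≡a) = z≢a (reduce z≡a)
      outside b~z _   (inj₂ z≡b) = ~⇒≢ b~z (sym (reduce z≡b))
      ¬square-ab : ∀ {s t} → a ~ s → s ~ t → t ~ b → s ≢ b → t ≢ a → ⊥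
      ¬square-ab as st tb s≢b t≢a = ¬square (square ab (~-sym tb) (~-sym st) (~-sym as) (≢-sym t≢a) (≢-sym s≢b))
      ¬square-ba : ∀ {s t} → b ~ s → s ~ t → t ~ a → s ≢ a → t ≢ b → ⊥
      ¬square-ba bs st ta s≢a t≢b = ¬square-ab (~-sym ta) (~-sym st) (~-sym bs) t≢b s≢a
      ¬closed : ∀ {u v s t} → u ≡ a ⊎ u ≡ b → v ≡ a ⊎ v ≡ b → u ~ v →
                u ~ s → s ~ t → t ~ v → s ≢ v → t ≢ u → ⊥
      ¬closed (inj₁ refl) (inj₁ refl) uv = contradiction uv (even≁ refl)
      ¬closed (inj₁ refl) (inj₂ refl) _  = ¬square-ab
      ¬closed (inj₂ refl) (inj₁ refl) _  = ¬square-ba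
      ¬closed (inj₂ refl) (inj₂ refl) uv = contradiction uv (even≁ refl)

    blockAt : ∀ {a b} → a ~ b → BlockAt a b
    blockAt {a} {b} ab with any? (λ c → any? λ d →
      Adj? G b c ×-dec Adj? G c d ×-dec Adj? G d a ×-dec ¬? (a ≟ᶠ c) ×-dec ¬? (b ≟ᶠ d))
    ... | yes (_ , _ , bc , cd , da , a≢c , b≢d) = squareBlock (square ab bc cd da a≢c b≢d)
    ... | no ¬sq = edgeBlock ab λ (square _ bc cd da a≢c b≢d) → ¬sq (_ , _ , bc , cd , da , a≢c , b≢d)

    -- The component of x′ in G ∖ D shrinks from stage to stage and loses x′ each time, so that
    -- the vertices left behind are distinct.
    record Stage (k : ℕ) : Set₁ where
      field
        block : Block
      open Block block public
      field
        {x y x′}  : Fin n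
        Dx        : D x
        Dy        : D y
        x~y       : x ~ y
        x~x′      : x ~ x′
        ¬Dx′      : ¬ D x′
        left      : Fin k → Fin n
        left-inj  : Injective _≡_ _≡_ left
        left-far  : ∀ i → ¬ Star Off x′ (left i)

    start : ∀ {x y} → x ~ y → Stage 0
    start x~y = let (z , y~z , ¬Dz) = escape in record
      { block = block ; Dx = Dy ; Dy = Dx ; x~y = ~-sym x~y ; x~x′ = y~z ; ¬Dx′ = ¬Dz
      ; left = λ () ; left-inj = λ {i} → λ { {()} } ; left-far = λ () }
      where open BlockAt (blockAt x~y)

    next : ∀ {k} → Stage k → Stage (suc k)
    next {k} S = record
      { block = B.block ; Dx = B.Dy ; Dy = B.Dx ; x~y = ~-sym x~x′ ; x~x′ = x′~x″ ; ¬Dx′ = ¬Bx″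
      ; left = left′ ; left-inj = left′-inj ; left-far = left′-far }
      where
      open Stage S
      module B = BlockAt (blockAt x~x′)
      x″    = proj₁ B.escape
      x′~x″ = proj₁ (proj₂ B.escape)
      ¬Bx″  = proj₂ (proj₂ B.escape)

      -- A second neighbour t of x′ in `D` would be adjacent to y, and the 4-cycle x x′ t y would
      -- pull x′ into `D`.
      D∩N[x′] : ∀ {t} → D t → x′ ~ t → t ≡ x
      D∩N[x′] {t} Dt x′~t with t ≟ᶠ x
      ... | yes t≡x = t≡x
      ... | no  t≢x = contradiction
        (closed Dx Dy x~y x~x′ x′~t (biclique Dt Dy λ eq → bip x~y (trans (even x~x′ x′~t) eq))
          (λ { refl → ¬Dx′ Dy }) t≢x) ¬Dx′

      -- On the side of x, such a v would be a neighbour of x′ in `D`. On the other side v is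
      -- adjacent to x, and `twin` gives a 4-cycle x x′ p v through an edge of `D`.
      D∩B : ∀ {v} → D v → v ≢ x → ¬ B.D v
      D∩B {v} Dv v≢x Bv with side v ≟ᵇ side x
      ... | yes v≡x = v≢x (D∩N[x′] Dv (~-sym (B.biclique Bv B.Dy λ eq → bip x~x′ (trans (sym v≡x) eq))))
      ... | no  v≢x =
        let x~v = biclique Dx Dv (≢-sym v≢x)
            x′≢v = λ { refl → ¬Dx′ Dv }
            (p , p≢x , x′~p , p~v) = B.twin Bv x~v (≢-sym x′≢v)
        in ¬Dx′ (closed Dx Dv x~v x~x′ x′~p p~v x′≢v p≢x)

      -- Otherwise the walk is a detour around the edge x′ x of the new block.
      no-return : ∀ {v} → Star B.Off x″ v → ¬ x ~ v
      no-return p x~v =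
        ¬wound (B.detour-wound B.Dy B.Dx (~-sym x~x′) x′~x″ x~v ¬Bx″ (B.Off-end ¬Bx″ p) p)

      -- A vertex of `D` opposite to x is adjacent to x. One on the side of x is adjacent to y,
      -- which is outside the new block by `D∩B`, so the walk extends to the neighbour y of x.
      far : ∀ {v} → Star B.Off x″ v → ¬ D v
      far {v} p Dv with side v ≟ᵇ side x
      ... | no  v≢x = no-return p (biclique Dx Dv (≢-sym v≢x))
      ... | yes v≡x = no-return (p ◅◅ (B.Off-end ¬Bx″ p , D∩B Dy (≢-sym (~⇒≢ x~y)) , v~y) ◅ ε) x~y
        where v~y = biclique Dv Dy λ eq → bip x~y (trans (sym v≡x) eq)

      lift : ∀ {u v} → Star B.Off x″ u → Star B.Off u v → Star Off u v
      lift p ε                          = ε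
      lift p (e@(_ , _ , u~w) ◅ q) = (far p , far p′ , u~w) ◅ lift p′ q
        where p′ = p ◅◅ e ◅ ε

      shrink : ∀ {v} → Star B.Off x″ v → Star Off x′ v
      shrink q = (¬Dx′ , far ε , x′~x″) ◅ lift ε q

      left′ : Fin (suc k) → Fin n
      left′ zero    = x′
      left′ (suc i) = left i

      left′-inj : Injective _≡_ _≡_ left′
      left′-inj {zero}  {zero}  _  = refl
      left′-inj {zero}  {suc j} eq = contradiction (subst (Star Off x′) eq ε) (left-far j)
      left′-inj {suc i} {zero}  eq = contradiction (subst (Star Off x′) (sym eq) ε) (left-far i)
      left′-inj {suc i} {suc j} eq = cong suc (left-inj eq)

      left′-far : ∀ i → ¬ Star B.Off x″ (left′ i)
      left′-far zero    p = B.Off-end ¬Bx″ p B.Dy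
      left′-far (suc i) p = left-far i (shrink p)

    edgeless : ∀ {x y} → ¬ x ~ y
    -- Stage n + 1 would have left behind n + 1 distinct vertices out of n.
    edgeless x~y = ℕ.1+n≰n (injective⇒≤ (Stage.left-inj (stages (suc n))))
      where
      stages : ∀ k → Stage k
      stages zero    = start x~y
      stages (suc k) = next (stages k)

-- Folds

module Fold (G : Graph (suc n)) {v u : Fin (suc n)} (v≢u : v ≢ u)
            (Nv⊆Nu : ∀ {z} → Adj G v z → Adj G u z) where

  retract : Fin (suc n) → Fin n
  retract w with v ≟ᶠ w
  ... | yes _   = punchOut v≢u
  ... | no  v≢w = punchOut v≢w

  retract-fold : ∀ w → punchIn v (retract w) ≡ w ⊎ (w ≡ v × punchIn v (retract w) ≡ u)
  retract-fold w with v ≟ᶠ w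
  ... | yes v≡w = inj₂ (sym v≡w , punchIn-punchOut v≢u)
  ... | no  v≢w = inj₁ (punchIn-punchOut v≢w)

  retract-punchIn : ∀ w → retract (punchIn v w) ≡ w
  retract-punchIn w with retract-fold (punchIn v w)
  ... | inj₁ eq       = punchIn-injective v _ _ eq
  ... | inj₂ (eq , _) = contradiction eq (punchInᵢ≢i v w)

  -- An edge at v moves to u since N(v) ⊆ N(u). Colourings are pulled back along this homomorphism.
  retract-adj : ∀ {x y} → Adj G x y → Adj (G ∖ v) (retract x) (retract y)
  retract-adj {x} {y} xy with retract-fold x | retract-fold y
  ... | inj₁ x≡          | inj₁ y≡          = subst₂ (Adj G) (sym x≡) (sym y≡) xy
  ... | inj₁ x≡          | inj₂ (refl , y≡) = subst₂ (Adj G) (sym x≡) (sym y≡) (sym-Adj G (Nv⊆Nu (sym-Adj G xy)))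
  ... | inj₂ (refl , x≡) | inj₁ y≡          = subst₂ (Adj G) (sym x≡) (sym y≡) (Nv⊆Nu xy)
  ... | inj₂ (refl , _)  | inj₂ (refl , _)  = contradiction xy (irrefl-Adj G refl)

  bipartite : Bipartite G → Bipartite (G ∖ v)
  bipartite (side , bip) = side ∘ punchIn v , bip

  connected : Connected G → Connected (G ∖ v)
  connected (r , walk) = retract r , λ x y →
    subst₂ (Star (Adj (G ∖ v))) (retract-punchIn x) (retract-punchIn y)
      (gmap retract retract-adj (walk (punchIn v x) (punchIn v y)))

  hasEdge : HasEdge G → HasEdge (G ∖ v)
  hasEdge (x , y , xy) = retract x , retract y , retract-adj xy

  sub : {H : Graph m} → H ⊑ (G ∖ v) → H ⊑ G
  sub (f , f-inj , f-adj) = punchIn v ∘ f , (λ eq → f-inj (punchIn-injective v _ _ eq)) , f-adj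

  wound : Wound (G ∖ v) → Wound G
  wound (c , proper , x , p , p≢0) =
    c ∘ retract , (λ xy → proper (retract-adj xy)) , punchIn v x , gmap (punchIn v) (λ e → e) p ,
    λ eq → p≢0 (trans (sym (trans
      (winding-gmap {S = Adj G} (c ∘ retract) (punchIn v) (λ e → e) p)
      (winding-cong (λ w → cong c (retract-punchIn w)) p))) eq)

-- Walks from x never leave {x, y}, which by connectedness is the whole vertex set.
edge-≅ : (G : Graph n) → Connected G → ∀ {x y} → Adj G x y →
  (∀ {z} → Adj G x z → z ≡ y) → (∀ {z} → Adj G y z → z ≡ x) → G ≅ K 2
edge-≅ {n} G (_ , walk) {x} {y} xy Nx Ny =
  mk↔ₛ′ to from to∘from from∘to , λ a b → mk⇔ (adj⇒ a b) (adj⇐ a b)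
  where
  to : Fin n → Fin 2
  to z with z ≟ᶠ x
  ... | yes _ = # 0
  ... | no  _ = # 1
  from : Fin 2 → Fin n
  from zero       = x
  from (suc zero) = y
  ends : ∀ {a b} → a ≡ x ⊎ a ≡ y → Star (Adj G) a b → b ≡ x ⊎ b ≡ y
  ends a ε                   = a
  ends (inj₁ refl) (e ◅ p)   = ends (inj₂ (Nx e)) p
  ends (inj₂ refl) (e ◅ p)   = ends (inj₁ (Ny e)) p
  to∘from : ∀ i → to (from i) ≡ i
  to∘from zero with x ≟ᶠ x
  ... | yes _   = refl
  ... | no  x≢x = contradiction refl x≢x
  to∘from (suc zero) with y ≟ᶠ x
  ... | yes y≡x = contradiction xy (irrefl-Adj G (sym y≡x))
  ... | no  _   = refl
  from∘to : ∀ a → from (to a) ≡ a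
  from∘to a with a ≟ᶠ x | ends (inj₁ refl) (walk x a)
  ... | yes a≡x | _        = sym a≡x
  ... | no  a≢x | inj₁ a≡x = contradiction a≡x a≢x
  ... | no  _   | inj₂ a≡y = sym a≡y
  adj⇒ : ∀ a b → Adj G a b → to a ≢ to b
  adj⇒ a b ab eq = irrefl-Adj G (trans (sym (from∘to a)) (trans (cong from eq) (from∘to b))) ab
  adj⇐ : ∀ a b → to a ≢ to b → Adj G a b
  adj⇐ a b a≢b = subst₂ (Adj G) (from∘to a) (from∘to b) (adj (to a) (to b) a≢b)
    where
    adj : ∀ i j → i ≢ j → Adj G (from i) (from j)
    adj zero       zero       i≢j = contradiction refl i≢j
    adj zero       (suc zero) _   = xy
    adj (suc zero) zero       _   = sym-Adj G xy
    adj (suc zero) (suc zero) i≢j = contradiction refl i≢j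

-- Induction on the number of vertices: a fold preserves all hypotheses. With no fold left, either
-- some vertex has a single neighbour and the graph is an edge, or the descent applies.
foldsToEdge : (G : Graph n) → Bipartite G → Connected G → HasEdge G →
              ¬ (H₁ ⊑ G) → ¬ (H₂ ⊑ G) → ¬ Wound G → FoldsToEdge G
foldsToEdge {zero} G _ _ (() , _)
foldsToEdge {suc n} G bip con (x , y , xy) ¬H₁ ¬H₂ ¬wound
  with any? (λ v → any? λ u → ¬? (v ≟ᶠ u) ×-dec all? λ z → Adj? G v z →-dec Adj? G u z)
... | yes (v , u , v≢u , Nv⊆Nu) =
  fold v u v≢u (Nv⊆Nu _)
    (foldsToEdge (G ∖ v) (bipartite bip) (connected con) (hasEdge (x , y , xy))
      (¬H₁ ∘ sub {H = H₁}) (¬H₂ ∘ sub {H = H₂}) (¬wound ∘ wound))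
  where open Fold G v≢u (Nv⊆Nu _)
... | no ¬fold with any? (λ a → any? λ b → Adj? G a b ×-dec all? λ z → Adj? G b z →-dec (z ≟ᶠ a))
...   | yes (a , b , ab , Nb) = done (edge-≅ G con ab Na (Nb _))
  where
  -- As a is the only neighbour of b, another neighbour z of a would satisfy N(b) ⊆ N(z) and allow a
  -- fold.
  Na : ∀ {z} → Adj G a z → z ≡ b
  Na {z} az = decidable-stable (z ≟ᶠ b) λ z≢b →
    ¬fold (b , z , ≢-sym z≢b , λ w bw → subst (Adj G z) (sym (Nb w bw)) (sym-Adj G az))
...   | no ¬leaf = ⊥-elim (edgeless xy)
  where
  open Bipartition G (proj₁ bip) (proj₂ bip)
  stiff : ∀ {v u} → v ≢ u → ∃[ z ] Adj G v z × ¬ Adj G u z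
  stiff {v} {u} v≢u = decidable-stable (any? λ z → Adj? G v z ×-dec ¬? (Adj? G u z)) λ ¬z →
    ¬fold (v , u , v≢u , λ z vz → decidable-stable (Adj? G u z) λ ¬uz → ¬z (z , vz , ¬uz))
  branch : ∀ {a b} → Adj G a b → ∃[ z ] Adj G b z × z ≢ a
  branch {a} {b} ab = decidable-stable (any? λ z → Adj? G b z ×-dec ¬? (z ≟ᶠ a)) λ ¬z →
    ¬leaf (a , b , ab , λ z bz → decidable-stable (z ≟ᶠ a) λ z≢a → ¬z (z , bz , z≢a))
  open Descent ¬H₁ ¬H₂ ¬wound stiff branch

-- Locally constant functions on the interval

width : ℕ → ℚ
width zero    = 1ℚ
width (suc k) = ½ ℚ.* width k

width-halves : ∀ k → width (suc k) ℚ.+ width (suc k) ≡ width k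
width-halves k = trans (sym (ℚ.*-distribʳ-+ (width k) ½ ½)) (ℚ.*-identityˡ (width k))

0≤width : ∀ k → 0ℚ ℚ.≤ width k
0≤width zero    = ℚ.nonNegative⁻¹ 1ℚ
0≤width (suc k) = subst (ℚ._≤ width (suc k)) (ℚ.*-zeroʳ ½) (ℚ.*-monoˡ-≤-nonNeg ½ (0≤width k))

-- `mkℚᵘ (+ 1) k` is 1/(k+1); the step is 1/(2(k+1)) ≤ 1/(k+2).
width-bound : ∀ k → toℚᵘ (width k) ℚᵘ.≤ mkℚᵘ (+ 1) k
width-bound zero    = ℚᵘ.≤-refl
width-bound (suc k) = begin
  toℚᵘ (½ ℚ.* width k)        ≃⟨ ℚ.toℚᵘ-homo-* ½ (width k) ⟩
  toℚᵘ ½ ℚᵘ.* toℚᵘ (width k)  ≤⟨ ℚᵘ.*-monoʳ-≤-nonNeg (toℚᵘ ½) (width-bound k) ⟩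
  toℚᵘ ½ ℚᵘ.* mkℚᵘ (+ 1) k    ≤⟨ ℚᵘ.*≤* (ℤ.+≤+ (ℕ.s≤s (ℕ.≤-trans
      (ℕ.m≤n+m (suc (k ℕ.+ 0)) k) (ℕ.≤-reflexive (sym (ℕ.+-identityʳ _)))))) ⟩
  mkℚᵘ (+ 1) (suc k)          ∎
  where open ℚᵘ.≤-Reasoning

archimedean : ∀ {ε} → 0ℚ ℚ.< ε → ∃[ k ] width k ℚ.< ε
archimedean {mkℚ (+ zero) d c} (ℚ.*<* (ℤ.+<+ ()))
-- The denominator of ε is d + 1, and the width at d + 1 is at most 1/(d+2) < 1/(d+1) ≤ ε.
archimedean {mkℚ (+ suc m) d c} _ = suc d ,
  ℚ.toℚᵘ-cancel-< (ℚᵘ.≤-<-trans (width-bound (suc d)) (ℚᵘ.*<* (ℤ.+<+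
    (ℕ.≤-trans (ℕ.s≤s (ℕ.≤-reflexive (ℕ.+-identityʳ (suc d)))) (ℕ.m≤m+n (suc (suc d)) _)))))

module _ where
  open ℚ-Solver.+-*-Solver

  +-∸ : ∀ p q → (p ℚ.+ q) ℚ.- p ≡ q
  +-∸ = solve 2 (λ p q → (p :+ q) :- p := q) refl

  +-∸-comm : ∀ p q → (p ℚ.+ q) ℚ.- q ≡ p
  +-∸-comm = solve 2 (λ p q → (p :+ q) :- q := p) refl

  neg-∸ : ∀ p q → ℚ.- (p ℚ.- q) ≡ q ℚ.- p
  neg-∸ = solve 2 (λ p q → :- (p :- q) := q :- p) refl

  +-exchange : ∀ q w d → (q ℚ.+ w) ℚ.+ (d ℚ.- w) ≡ q ℚ.+ (0ℚ ℚ.+ d)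
  +-exchange = solve 3 (λ q w d → (q :+ w) :+ (d :- w) := q :+ (con 0ℚ :+ d)) refl

∣-∣≤ : ∀ {a w p q} → a ℚ.≤ p → p ℚ.≤ a ℚ.+ w → a ℚ.≤ q → q ℚ.≤ a ℚ.+ w → ℚ.∣ p ℚ.- q ∣ ℚ.≤ w
∣-∣≤ {a} {w} {p} {q} a≤p p≤ a≤q q≤ with ℚ.∣p∣≡p∨∣p∣≡-p (p ℚ.- q)
... | inj₁ eq = subst₂ ℚ._≤_ (sym eq) (+-∸ a w) (ℚ.+-mono-≤ p≤ (ℚ.neg-antimono-≤ a≤q))
... | inj₂ eq = subst₂ ℚ._≤_ (sym (trans eq (neg-∸ p q))) (+-∸ a w) (ℚ.+-mono-≤ q≤ (ℚ.neg-antimono-≤ a≤p))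

+-cancelʳ-≤ : ∀ {p q} r → p ℚ.+ r ℚ.≤ q ℚ.+ r → p ℚ.≤ q
+-cancelʳ-≤ {p} {q} r le = subst₂ ℚ._≤_ (+-∸-comm p r) (+-∸-comm q r) (ℚ.+-monoˡ-≤ (ℚ.- r) le)

≤-pointwise : ∀ x y → (∀ n → seq x n ℚ.≤ seq y n) → x ≤ y
≤-pointwise x y x≤y (e , 0<e , M , y<x) = ℚ.<-irrefl refl (begin-strict
  seq y M         ≡⟨ ℚ.+-identityʳ (seq y M) ⟨
  seq y M ℚ.+ 0ℚ  <⟨ ℚ.+-monoʳ-< (seq y M) 0<e ⟩
  seq y M ℚ.+ e   ≤⟨ y<x M ℕ.≤-refl ⟩
  seq x M         ≤⟨ x≤y M ⟩
  seq y M         ∎)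
  where open ℚ.≤-Reasoning

≈-pointwise : ∀ x y → (∀ n → seq x n ≡ seq y n) → x ≈ y
≈-pointwise x y eq = ≤-pointwise x y (ℚ.≤-reflexive ∘ eq) , ≤-pointwise y x (ℚ.≤-reflexive ∘ sym ∘ eq)

Unit : ℚ → Set
Unit q = 0ℚ ℚ.≤ q × q ℚ.≤ 1ℚ

point : ∀ q → Unit q → I
point q (0≤q , q≤1) = fromℚ q , ≤-pointwise 0ℝ (fromℚ q) (λ _ → 0≤q) , ≤-pointwise (fromℚ q) 1ℝ (λ _ → q≤1)

unit-0 : Unit 0ℚ
unit-0 = ℚ.≤-refl , 0≤width 0

unit-1 : Unit 1ℚ
unit-1 = 0≤width 0 , ℚ.≤-refl

within-close : ∀ x y {d w δ M K} → w ℚ.< d → (∀ n → M ℕ.≤ n → 0ℚ ℚ.+ d ℚ.≤ seq δ n) →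
  (∀ n → K ℕ.≤ n → seq x n ℚ.≤ seq y n ℚ.+ w) → x < y + δ
within-close x y {d} {w} {δ} {M} {K} w<d d≤δ x≤ =
  -- The rational margin that `<` demands.
  d ℚ.- w , subst (ℚ._< d ℚ.- w) (ℚ.+-inverseʳ w) (ℚ.+-monoˡ-< (ℚ.- w) w<d) , M ℕ.⊔ K , λ n M⊔K≤n → begin
    seq x n ℚ.+ (d ℚ.- w)            ≤⟨ ℚ.+-monoˡ-≤ (d ℚ.- w) (x≤ n (ℕ.m⊔n≤o⇒n≤o M K M⊔K≤n)) ⟩
    seq y n ℚ.+ w ℚ.+ (d ℚ.- w)      ≡⟨ +-exchange (seq y n) w d ⟩
    seq y n ℚ.+ (0ℚ ℚ.+ d)           ≤⟨ ℚ.+-monoʳ-≤ (seq y n) (d≤δ n (ℕ.m⊔n≤o⇒m≤o M K M⊔K≤n)) ⟩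
    seq y n ℚ.+ seq δ n              ∎
  where open ℚ.≤-Reasoning

LocallyConstant : {A : Set} → (I → A) → Set
LocallyConstant f = ∀ s → ∃[ δ ] 0ℝ < δ × ∀ t → Within δ (proj₁ s) (proj₁ t) → f t ≡ f s

module Bisection {A : Set} (_≟_ : DecidableEquality A) (f : I → A) (a₀ : A) where

  record Bracket (k : ℕ) : Set where
    field
      {low high} : ℚ
      low-unit   : Unit low
      high-unit  : Unit high
      gap        : high ≡ low ℚ.+ width k
      f-low      : f (point low low-unit) ≡ a₀
      f-high     : f (point high high-unit) ≢ a₀
  open Bracket

  module Midpoint {k} (B : Bracket k) where
    mid : ℚ
    mid = low B ℚ.+ width (suc k)

    high≡ : high B ≡ mid ℚ.+ width (suc k)
    high≡ = trans (gap B) (trans (cong (low B ℚ.+_) (sym (width-halves k))) (sym (ℚ.+-assoc (low B) _ _)))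

    low≤mid : low B ℚ.≤ mid
    low≤mid = subst (ℚ._≤ mid) (ℚ.+-identityʳ (low B)) (ℚ.+-monoʳ-≤ (low B) (0≤width (suc k)))

    mid≤high : mid ℚ.≤ high B
    mid≤high = subst₂ ℚ._≤_ (ℚ.+-identityʳ mid) (sym high≡) (ℚ.+-monoʳ-≤ mid (0≤width (suc k)))

    mid-unit : Unit mid
    mid-unit = ℚ.≤-trans (proj₁ (low-unit B)) low≤mid , ℚ.≤-trans mid≤high (proj₂ (high-unit B))

    half : Σ (Bracket (suc k)) λ B′ → low B ℚ.≤ low B′ × high B′ ℚ.≤ high B
    half with f (point mid mid-unit) ≟ a₀
    ... | yes f-mid = record
      { low-unit = mid-unit ; high-unit = high-unit B ; gap = high≡ ; f-low = f-mid ; f-high = f-high B }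
      , low≤mid , ℚ.≤-refl
    ... | no f-mid = record
      { low-unit = low-unit B ; high-unit = mid-unit ; gap = refl ; f-low = f-low B ; f-high = f-mid }
      , ℚ.≤-refl , mid≤high

  open Midpoint using (half)

  module Limit (B₀ : Bracket 0) where

    bracket : ∀ k → Bracket k
    bracket zero    = B₀
    bracket (suc k) = proj₁ (half (bracket k))

    a b : ℕ → ℚ
    a k = low (bracket k)
    b k = high (bracket k)

    a≤b : ∀ k → a k ℚ.≤ b k
    a≤b k = subst₂ ℚ._≤_ (ℚ.+-identityʳ (a k)) (sym (gap (bracket k))) (ℚ.+-monoʳ-≤ (a k) (0≤width k))

    nested : ∀ {k n} → k ℕ.≤′ n → a k ℚ.≤ a n × b n ℚ.≤ b k
    nested ℕ.≤′-refl = ℚ.≤-refl , ℚ.≤-refl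
    nested (ℕ.≤′-step {n} k≤n) =
      ℚ.≤-trans (proj₁ (nested k≤n)) (proj₁ (proj₂ (half (bracket n)))) ,
      ℚ.≤-trans (proj₂ (proj₂ (half (bracket n)))) (proj₂ (nested k≤n))

    a-mono : ∀ {k n} → k ℕ.≤ n → a k ℚ.≤ a n
    a-mono = proj₁ ∘ nested ∘ ℕ.≤⇒≤′

    a≤b-far : ∀ {k n} → k ℕ.≤ n → a n ℚ.≤ b k
    a≤b-far {n = n} k≤n = ℚ.≤-trans (a≤b n) (proj₂ (nested (ℕ.≤⇒≤′ k≤n)))

    a≤a+width : ∀ {k n} → k ℕ.≤ n → a n ℚ.≤ a k ℚ.+ width k
    a≤a+width {k} {n} k≤n = subst (a n ℚ.≤_) (gap (bracket k)) (a≤b-far k≤n)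

    limit : ℝ
    limit .seq = a
    limit .cauchy e 0<e with archimedean 0<e
    ... | k , width<e = k , λ m n k≤m k≤n → ℚ.≤-<-trans
      (∣-∣≤ (a-mono k≤m) (a≤a+width k≤m) (a-mono k≤n) (a≤a+width k≤n)) width<e

    limitᴵ : I
    limitᴵ = limit , ≤-pointwise 0ℝ limit (proj₁ ∘ low-unit ∘ bracket) , ≤-pointwise limit 1ℝ (proj₂ ∘ low-unit ∘ bracket)

    -- Both ends of a bracket narrower than δ lie within δ of the limit, yet only the lower one has
    -- the value `a₀`.
    not-constant-near-limit : ¬ LocallyConstant f
    not-constant-near-limit lc with lc limitᴵ
    ... | δ , (d , 0<d , M , d≤δ) , const with archimedean 0<d
    ... | k , width<d = f-high (bracket k) (trans
        (const _ (close (b k) a≤b+w b≤a+w))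
        (trans (sym (const _ (close (a k) a≤a+w a≤a+w′)))
          (f-low (bracket k))))
      where
      close : ∀ q → (∀ n → k ℕ.≤ n → a n ℚ.≤ q ℚ.+ width k) → (∀ n → k ℕ.≤ n → q ℚ.≤ a n ℚ.+ width k) →
              Within δ limit (fromℚ q)
      close q a≤q q≤a =
        within-close limit (fromℚ q) {δ = δ} width<d d≤δ a≤q , within-close (fromℚ q) limit {δ = δ} width<d d≤δ q≤a
      weaken : ∀ {p q} → p ℚ.≤ q → p ℚ.≤ q ℚ.+ width k
      weaken {p} {q} p≤q = subst (ℚ._≤ q ℚ.+ width k) (ℚ.+-identityʳ p) (ℚ.+-mono-≤ p≤q (0≤width k))
      a≤b+w : ∀ n → k ℕ.≤ n → a n ℚ.≤ b k ℚ.+ width k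
      a≤b+w n k≤n = weaken (a≤b-far k≤n)
      b≤a+w : ∀ n → k ℕ.≤ n → b k ℚ.≤ a n ℚ.+ width k
      b≤a+w n k≤n = subst (ℚ._≤ a n ℚ.+ width k) (sym (gap (bracket k))) (ℚ.+-monoˡ-≤ (width k) (a-mono k≤n))
      a≤a+w : ∀ n → k ℕ.≤ n → a n ℚ.≤ a k ℚ.+ width k
      a≤a+w n = a≤a+width
      a≤a+w′ : ∀ n → k ℕ.≤ n → a k ℚ.≤ a n ℚ.+ width k
      a≤a+w′ n k≤n = weaken (a-mono k≤n)

-- If the values at 0 and 1 differ, bisection traps a change of value. It compares values at
-- rational points only, which decidable equality on `A` allows.
interval-connected : {A : Set} → DecidableEquality A → (f : I → A) → LocallyConstant f →
                     f (point 0ℚ unit-0) ≡ f (point 1ℚ unit-1)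
interval-connected _≟_ f lc = decidable-stable (_ ≟ _) λ f0≢f1 →
  Bisection.Limit.not-constant-near-limit _≟_ f (f (point 0ℚ unit-0))
    (record { low-unit = unit-0 ; high-unit = unit-1 ; gap = refl ; f-low = refl ; f-high = ≢-sym f0≢f1 }) lc

-- Vertices and paths of the homomorphism complex

-- A vertex of the cell carrying `p`, as recorded in `support`. The choice may jump along a path;
-- only its windings are stable.
colour-of : {G : Graph m} {H : Graph n} → Hom G H → Fin m → Fin n
colour-of p v = proj₁ (proj₁ (support p) v)

uniform-bound : (x : Fin m → ℝ) → (∀ v → 0ℝ < x v) →
  ∃[ e ] 0ℚ ℚ.< e × ∀ v → ∃[ M ] ∀ n → M ℕ.≤ n → e ℚ.≤ seq (x v) n
uniform-bound {zero}  x _   = 1ℚ , ℚ.positive⁻¹ 1ℚ , λ ()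
uniform-bound {suc m} x 0<x with 0<x zero | uniform-bound (x ∘ suc) (0<x ∘ suc)
... | d , 0<d , M , d≤x | e , 0<e , e≤x = d ℚ.⊓ e , 0<d⊓e , λ where
    zero    → M , λ n M≤n → ℚ.≤-trans (ℚ.p⊓q≤p d e) (subst (ℚ._≤ seq (x zero) n) (ℚ.+-identityˡ d) (d≤x n M≤n))
    (suc v) → proj₁ (e≤x v) , λ n M≤n → ℚ.≤-trans (ℚ.p⊓q≤q d e) (proj₂ (e≤x v) n M≤n)
  where
  0<d⊓e : 0ℚ ℚ.< d ℚ.⊓ e
  0<d⊓e with ℚ.⊓-sel d e
  ... | inj₁ eq = subst (0ℚ ℚ.<_) (sym eq) 0<d
  ... | inj₂ eq = subst (0ℚ ℚ.<_) (sym eq) 0<e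

-- With δ = e a lower bound for the chosen coordinates of `p`, the strict inequality p < q + e
-- leaves a positive margin for those of `q`.
near-support : {G : Graph m} {H : Graph n} (p : Hom G H) →
  ∃[ δ ] 0ℝ < δ × ∀ (q : Hom G H) → Near δ p q → ∀ v → 0ℝ < coord q v (colour-of p v)
near-support p with uniform-bound (λ v → coord p v (colour-of p v)) (λ v → proj₂ (proj₁ (support p) v))
... | e , 0<e , e≤p = fromℚ e , (e , 0<e , 0 , λ _ _ → ℚ.≤-reflexive (ℚ.+-identityˡ e)) , λ q near v →
  let (d , 0<d , K , p+d≤q+e) = proj₁ (near v (colour-of p v))
      (M , e≤pv) = e≤p v
  in d , 0<d , M ℕ.⊔ K , λ n M⊔K≤n → +-cancelʳ-≤ e (begin
    0ℚ ℚ.+ d ℚ.+ e    ≡⟨ cong (ℚ._+ e) (ℚ.+-identityˡ d) ⟩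
    d ℚ.+ e           ≡⟨ ℚ.+-comm d e ⟩
    e ℚ.+ d           ≤⟨ ℚ.+-monoˡ-≤ d (e≤pv n (ℕ.m⊔n≤o⇒m≤o M K M⊔K≤n)) ⟩
    _                 ≤⟨ p+d≤q+e n (ℕ.m⊔n≤o⇒n≤o M K M⊔K≤n) ⟩
    seq (coord q v (colour-of p v)) n ℚ.+ e ∎)
  where open ℚ.≤-Reasoning

weight : {A : Set} → Dec A → ℝ
weight (yes _) = 1ℝ
weight (no _)  = 0ℝ

0≤weight : {A : Set} (a? : Dec A) → 0ℝ ≤ weight a?
0≤weight (yes _) = ≤-pointwise 0ℝ 1ℝ λ _ → 0≤width 0
0≤weight (no _)  = ≤-pointwise 0ℝ 0ℝ λ _ → ℚ.≤-refl

0<weight : {A : Set} (a? : Dec A) → A → 0ℝ < weight a?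
0<weight (yes _) _ = 1ℚ , ℚ.positive⁻¹ 1ℚ , 0 , λ _ _ → ℚ.≤-refl
0<weight (no ¬a) a = contradiction a ¬a

weight-positive : {A : Set} (a? : Dec A) → 0ℝ < weight a? → A
weight-positive (yes a) _   = a
weight-positive (no _)  0<0 = contradiction 0<0 (≤-pointwise 0ℝ 0ℝ λ _ → ℚ.≤-refl)

sum-weight : ∀ (k : Fin 3) → sum (λ i → weight (i ≟ᶠ k)) ≈ 1ℝ
sum-weight k = ≈-pointwise (sum λ i → weight (i ≟ᶠ k)) 1ℝ (pointwise k)
  where
  pointwise : ∀ k n → seq (sum λ i → weight (i ≟ᶠ k)) n ≡ 1ℚ
  pointwise zero             _ = refl
  pointwise (suc zero)       _ = refl
  pointwise (suc (suc zero)) _ = refl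

vertexOf : (G : Graph m) (c : Fin m → Fin 3) → Proper G c → Hom G (K 3)
vertexOf G c proper .coord v i = weight (i ≟ᶠ c v)
vertexOf G c proper .nonneg v i = 0≤weight (i ≟ᶠ c v)
vertexOf G c proper .total v = sum-weight (c v)
vertexOf G c proper .support =
  (λ v → c v , 0<weight (c v ≟ᶠ c v) refl) ,
  λ {x} {y} xy {i} {j} 0<i 0<j i≡j → proper xy
    (trans (sym (weight-positive (i ≟ᶠ c x) 0<i)) (trans i≡j (weight-positive (j ≟ᶠ c y) 0<j)))

colour-of-vertex : (G : Graph m) (c : Fin m → Fin 3) (proper : Proper G c) (p : Hom G (K 3)) →
                   p ≋ vertexOf G c proper → colour-of p ≗ c
colour-of-vertex G c proper p p≋c v with colour-of p v ≟ᶠ c v | proj₂ (proj₁ (support p) v) | p≋c v (colour-of p v)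
... | yes eq | _   | _         = eq
... | no _   | 0<p | (p≤0 , _) = contradiction 0<p p≤0

-- For t close to s, the colours chosen at s still have positive coordinates at t, so the old and
-- the new choice are vertices of the same cell.
winding-locally-constant : {G : Graph m} (γ : I → Hom G (K 3)) → Continuous γ →
  ∀ {x} (p : Star (Adj G) x x) → LocallyConstant (λ t → winding (colour-of (γ t)) p)
winding-locally-constant {G = G} γ γ-cont p s =
  let (e , 0<e , near⇒positive) = near-support (γ s)
      (δ , 0<δ , close⇒near)    = γ-cont s e 0<e
  in δ , 0<δ , λ t close →
    let q    = γ t
        old  = near⇒positive q (close⇒near t close)
        new  = λ v → proj₂ (proj₁ (support q) v)
        edge = proj₂ (support q)
    in winding-invariant (λ e → edge e (new _) (new _)) (λ e → edge e (new _) (old _))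
         (λ e → edge e (old _) (new _)) (λ e → edge e (old _) (old _)) p

path-winding : {G : Graph m} {c c′ : Fin m → Fin 3} (proper : Proper G c) (proper′ : Proper G c′) →
  Path (vertexOf G c proper) (vertexOf G c′ proper′) → ∀ {x} (p : Star (Adj G) x x) → winding c p ≡ winding c′ p
path-winding {G = G} {c} {c′} proper proper′ π p = begin
  winding c p                     ≡⟨ winding-cong (colour-of-vertex G c proper (γ t₀) (source t₀ (≈-pointwise 0ℝ 0ℝ λ _ → refl))) p ⟨
  winding (colour-of (γ t₀)) p    ≡⟨ interval-connected ℤ._≟_ _ (winding-locally-constant γ continuous p) ⟩
  winding (colour-of (γ t₁)) p    ≡⟨ winding-cong (colour-of-vertex G c′ proper′ (γ t₁) (target t₁ (≈-pointwise 1ℝ 1ℝ λ _ → refl))) p ⟩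
  winding c′ p                    ∎
  where
  open ≡-Reasoning
  open Path π
  t₀ t₁ : I
  t₀ = point 0ℚ unit-0
  t₁ = point 1ℚ unit-1

theorem4p7 : ∀ (n : ℕ) (G : Graph n) →
    Bipartite G → Connected G → HasEdge G →
    ¬ FoldsToEdge G → ¬ (H₁ ⊑ G) → ¬ (H₂ ⊑ G) →
    HomDisconnected G (K 3)
-- Two points have to be exhibited, while the hypothesis on folds is negative; deciding `Wound`
-- provides the colouring. It is compared with the colouring by sides, whose windings are 0.
theorem4p7 n G bip con edge ¬fold ¬H₁ ¬H₂ with wound? G con
... | no  ¬wound = contradiction (foldsToEdge G bip con edge ¬H₁ ¬H₂ ¬wound) ¬fold
... | yes (c , proper , x , p , p≢0) =
  vertexOf G c proper , vertexOf G _ proper₂ , λ path → p≢0 (trans (path-winding proper proper₂ path p) (winding₂ p))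
  where open Bipartition G (proj₁ bip) (proj₂ bip)
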